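{- Let $\mathsf F$ be an ${\rm LP}^{\rm MLN}$ program. A set $X$ of atoms is a soft stable model of $\mathsf F$ if and only if $\langle X,X\rangle$ is a soft equilibrium model of $\mathsf F$.
   Context: Propositional formulas are built from atoms and $\bot$ using $\land,\lor,\rightarrow$, with $\neg F$ standing for $F\rightarrow\bot$ and $\top$ for $\bot\rightarrow\bot$. An interpretation is identified with the set of atoms true in it; $X\models R$ is classical satisfaction. The reduct $F^X$ is obtained from $F$ by replacing every maximal subformula not (classically) satisfied by $X$ with $\bot$; for a set $\Gamma$ of formulas, $\Gamma^X=\{F^X\mid F\in\Gamma\}$. $X$ is a (standard) stable model of $\Gamma$ if $X$ is a minimal model (with respect to inclusion) of $\Gamma^X$. An ${\rm LP}^{\rm MLN}$ program is a finite set of weighted formulas $w:R$, where $R$ is a propositional formula and $w$ is a real number or the symbol $\alpha$ (infinite weight). $\overline{\mathsf F}$ is the set of formulas obtained from $\mathsf F$ by dropping weights, and $\mathsf F_X$ is the set of those $w:R$ in $\mathsf F$ with $X\models R$. $X$ is a soft stable model of $\mathsf F$ if $X$ is a stable model of $\overline{\mathsf F_X}$. An $HT$ interpretation is a pair $\langle Y,X\rangle$ of sets of atoms with $Y\subseteq X$. There are two worlds $h<t$. For a world $w$: $\langle Y,X,h\rangle$ satisfies an atom $p$ iff $p\in Y$; $\langle Y,X,t\rangle$ satisfies $p$ iff $p\in X$; $\bot$ is never satisfied; $\land$ and $\lor$ are interpreted as usual at $w$; $\langle Y,X,w\rangle$ satisfies $F\rightarrow G$ iff for every world $w'\ge w$,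 $\langle Y,X,w'\rangle$ does not satisfy $F$ or satisfies $G$. $\langle Y,X\rangle$ satisfies $F$ iff $\langle Y,X,h\rangle$ satisfies $F$. $\langle Y,X\rangle$ is a soft $HT$ model of $\mathsf F$ if it satisfies $R$ for every rule $w:R$ in $\mathsf F_X$. A total $HT$ interpretation $\langle X,X\rangle$ is a soft equilibrium model of $\mathsf F$ if for any proper subset $Y$ of $X$, $\langle Y,X\rangle$ is not a soft $HT$ model of $\mathsf F$. -}

module Defs where

open import Level using (Level; _⊔_; 0ℓ)
open import Data.Bool.Base using (Bool; true; false; _∧_; _∨_; not; if_then_else_; T)
open import Data.Bool.Properties using (T?)
open import Data.Empty using (⊥)
open import Data.Integer.Base using (+_)
open import Data.List.Base using (List; filter)
open import Data.List.Membership.Propositional using () renaming (_∈_ to _∈ˡ_)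
open import Data.Nat.Base using (ℕ; suc)
open import Data.Product.Base using (_×_; proj₁; ∃-syntax)
open import Data.Rational.Base using (ℚ; _/_; _+_; _-_; ∣_∣; _≤_)
open import Data.Sum.Base using (_⊎_)
open import Relation.Binary.PropositionalEquality.Core using (_≡_)
open import Relation.Nullary using (¬_)
open import Relation.Nullary.Decidable.Core using (Dec)
open import Relation.Unary using (Pred; _∈_; _⊆′_; _⊂′_; _≐′_)

private
  variable
    a ℓ : Level
    Atom : Set a

-- Real numbers as Bishop's regular sequences of rationals.
record ℝ : Set where
  field
    approx  : ℕ → ℚ
    regular : ∀ m n → ∣ approx m - approx n ∣ ≤ (+ 1 / suc m) + (+ 1 / suc n)

infixr 7 _and_
infixr 6 _or_
infixr 5 _⇒_

data Formula (Atom : Set a) : Set a where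
  atom         : Atom → Formula Atom
  bot          : Formula Atom
  _and_ _or_ _⇒_ : Formula Atom → Formula Atom → Formula Atom

neg : Formula Atom → Formula Atom
neg F = F ⇒ bot

top : Formula Atom
top = bot ⇒ bot

-- Sets of atoms are given by Boolean characteristic functions, so that
-- propositional satisfaction is two-valued, as in classical logic.
Interpretation : Set a → Set a
Interpretation Atom = Atom → Bool

⌊_⌋ : Interpretation Atom → Pred Atom 0ℓ
⌊ X ⌋ p = T (X p)

eval : Interpretation Atom → Formula Atom → Bool
eval X (atom p)  = X p
eval X bot       = false
eval X (F and G) = eval X F ∧ eval X G
eval X (F or G)  = eval X F ∨ eval X G
eval X (F ⇒ G)   = not (eval X F) ∨ eval X G

infix 4 _⊨_ _⊨?_ _⊨ˢ_ _⊫_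

_⊨_ : Interpretation Atom → Formula Atom → Set
X ⊨ F = T (eval X F)

_⊨?_ : (X : Interpretation Atom) (F : Formula Atom) → Dec (X ⊨ F)
X ⊨? F = T? (eval X F)

_⊨ˢ_ : Interpretation Atom → Pred (Formula Atom) ℓ → Set _
X ⊨ˢ Γ = ∀ F → F ∈ Γ → X ⊨ F

-- An unsatisfied formula is its own maximal unsatisfied subformula; the
-- maximal unsatisfied subformulas of a satisfied one lie in its immediate
-- subformulas.
reduct         : Interpretation Atom → Formula Atom → Formula Atom
reductChildren : Interpretation Atom → Formula Atom → Formula Atom

reduct X F = if eval X F then reductChildren X F else bot

reductChildren X (atom p)  = atom p
reductChildren X bot       = bot
reductChildren X (F and G) = reduct X F and reduct X G
reductChildren X (F or G)  = reduct X F or reduct X G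
reductChildren X (F ⇒ G)   = reduct X F ⇒ reduct X G

reductˢ : {Atom : Set a} → Interpretation Atom → Pred (Formula Atom) ℓ →
          Pred (Formula Atom) (a ⊔ ℓ)
reductˢ X Γ G = ∃[ F ] (F ∈ Γ × G ≡ reduct X F)

MinimalModel : Interpretation Atom → Pred (Formula Atom) ℓ → Set _
MinimalModel X Γ = X ⊨ˢ Γ × (∀ Y → ⌊ Y ⌋ ⊂′ ⌊ X ⌋ → ¬ (Y ⊨ˢ Γ))

StableModel : Interpretation Atom → Pred (Formula Atom) ℓ → Set _
StableModel X Γ = MinimalModel X (reductˢ X Γ)

data Weight : Set where
  real : ℝ → Weight
  α    : Weight

infix 4 _∶_

record WeightedFormula (Atom : Set a) : Set a where
  constructor _∶_
  field
    weight  : Weight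
    formula : Formula Atom

open WeightedFormula public

-- A finite set, listed; only membership in the list is ever used, so order
-- and repetitions play no role.
Program : Set a → Set a
Program Atom = List (WeightedFormula Atom)

dropWeights : {Atom : Set a} → Program Atom → Pred (Formula Atom) a
dropWeights 𝔽 R = ∃[ w ] ((w ∶ R) ∈ˡ 𝔽)

satisfiedPart : Program Atom → Interpretation Atom → Program Atom
satisfiedPart 𝔽 X = filter (λ r → X ⊨? formula r) 𝔽

SoftStableModel : Interpretation Atom → Program Atom → Set _
SoftStableModel X 𝔽 = StableModel X (dropWeights (satisfiedPart 𝔽 X))

data World : Set where
  h t : World

data _≤ʷ_ : World → World → Set where
  h≤h : h ≤ʷ h
  h≤t : h ≤ʷ t
  t≤t : t ≤ʷ t

-- The pair ⟨ Y , X ⟩ with Y = here and X = there.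
record HTInterpretation (Atom : Set a) : Set a where
  constructor ht
  field
    here       : Interpretation Atom
    there      : Interpretation Atom
    here⊆there : ⌊ here ⌋ ⊆′ ⌊ there ⌋

open HTInterpretation public

at : HTInterpretation Atom → World → Interpretation Atom
at I h = here I
at I t = there I

satisfiesAt : HTInterpretation Atom → World → Formula Atom → Set
satisfiesAt I w (atom p)  = p ∈ ⌊ at I w ⌋
satisfiesAt I w bot       = ⊥
satisfiesAt I w (F and G) = satisfiesAt I w F × satisfiesAt I w G
satisfiesAt I w (F or G)  = satisfiesAt I w F ⊎ satisfiesAt I w G
satisfiesAt I w (F ⇒ G)   =
  ∀ w′ → w ≤ʷ w′ → ¬ satisfiesAt I w′ F ⊎ satisfiesAt I w′ G

_⊫_ : HTInterpretation Atom → Formula Atom → Set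
I ⊫ F = satisfiesAt I h F

SoftHTModel : HTInterpretation Atom → Program Atom → Set _
SoftHTModel I 𝔽 = ∀ w R → (w ∶ R) ∈ˡ satisfiedPart 𝔽 (there I) → I ⊫ R

Total : HTInterpretation Atom → Set _
Total I = ⌊ here I ⌋ ≐′ ⌊ there I ⌋

total : Interpretation Atom → HTInterpretation Atom
total X = ht X X (λ _ p∈X → p∈X)

SoftEquilibriumModel : HTInterpretation Atom → Program Atom → Set _
SoftEquilibriumModel I 𝔽 =
  Total I ×
  (∀ Y (Y⊂X : ⌊ Y ⌋ ⊂′ ⌊ there I ⌋) →
    ¬ SoftHTModel (ht Y (there I) (proj₁ Y⊂X)) 𝔽)

{-# OPTIONS --safe #-}
-- For Y ⊆ X, the pair ⟨ Y , X ⟩ satisfies F exactly when Y satisfies the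
-- reduct of F by X: if X falsifies F, both fail (the former by persistence),
-- and otherwise the claim passes to the immediate subformulas.  Minimality
-- thus translates directly, and X always satisfies the reduct by X of any
-- formula it satisfies.
module Submission where

open import Defs
open import Data.Bool.Base using (T; true; false; not; _∧_; _∨_)
open import Data.List.Membership.Propositional.Properties using (∈-filter⁻)
open import Data.Product.Base using (_,_; proj₁; proj₂)
open import Data.Sum.Base using () renaming (map to map-⊎)
open import Function.Base using (_∘_; id)
open import Function.Bundles using (_⇔_; mk⇔; module Equivalence)
open import Relation.Binary.PropositionalEquality
  using (_≡_; refl; sym; trans; cong₂; subst)
open import Relation.Nullary.Reflects
  using (Reflects; ofʸ; ofⁿ; T-reflects; ¬-reflects; _×-reflects_; _⊎-reflects_)

map-reflects : ∀ {p q} {P : Set p} {Q : Set q} {b} →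
               (P → Q) → (Q → P) → Reflects P b → Reflects Q b
map-reflects f g (ofʸ p)  = ofʸ (f p)
map-reflects f g (ofⁿ ¬p) = ofⁿ (¬p ∘ g)

reflects⇒⇔ : ∀ {p} {P : Set p} {b} → Reflects P b → T b ⇔ P
reflects⇒⇔ (ofʸ p)  = mk⇔ (λ _ → p) _
reflects⇒⇔ (ofⁿ ¬p) = mk⇔ (λ ()) ¬p

module _ {a} {Atom : Set a} where

  module _ (X : Interpretation Atom) where

    -- Each subformula replaced by `bot` is already false in `X`, so no truth value in `X` changes.
    -- This makes `X` a model of its own reduct wherever it is a model of the original.
    eval-reduct         : ∀ F → eval X (reduct X F) ≡ eval X F
    eval-reductChildren : ∀ F → eval X (reductChildren X F) ≡ eval X F

    eval-reduct F with eval X F in eq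
    ... | true  = trans (eval-reductChildren F) eq
    ... | false = refl

    eval-reductChildren (atom p)  = refl
    eval-reductChildren bot       = refl
    eval-reductChildren (F and G) = cong₂ _∧_ (eval-reduct F) (eval-reduct G)
    eval-reductChildren (F or G)  = cong₂ _∨_ (eval-reduct F) (eval-reduct G)
    eval-reductChildren (F ⇒ G)   =
      cong₂ (λ b c → not b ∨ c) (eval-reduct F) (eval-reduct G)

  module _ (I : HTInterpretation Atom) where

    -- An implication holding at `h` was already tested at every world above `h`, including `t`, so
    -- no induction on its parts is needed.
    persistence : ∀ F → satisfiesAt I h F → satisfiesAt I t F
    persistence (atom p)  p∈Y       = here⊆there I p p∈Y
    persistence (F and G) (f , g)   = persistence F f , persistence G g
    persistence (F or G)  f⊎g       = map-⊎ (persistence F) (persistence G) f⊎g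
    persistence (F ⇒ G)   f⇒g t t≤t = f⇒g t h≤t

    -- The world `t` sees only itself, so satisfaction there is classical. `Reflects` also decides
    -- it, which is what lets `not b ∨ c` match the constructive disjunction in the clause for
    -- implication.
    satisfiesAt-t-reflects : ∀ F → Reflects (satisfiesAt I t F) (eval (there I) F)
    satisfiesAt-t-reflects (atom p)  = T-reflects (there I p)
    satisfiesAt-t-reflects bot       = ofⁿ λ ()
    satisfiesAt-t-reflects (F and G) =
      satisfiesAt-t-reflects F ×-reflects satisfiesAt-t-reflects G
    satisfiesAt-t-reflects (F or G)  =
      satisfiesAt-t-reflects F ⊎-reflects satisfiesAt-t-reflects G
    satisfiesAt-t-reflects (F ⇒ G)   =
      map-reflects (λ { f⇒g t t≤t → f⇒g }) (λ f⇒g → f⇒g t t≤t)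
        (¬-reflects (satisfiesAt-t-reflects F) ⊎-reflects satisfiesAt-t-reflects G)

    satisfiesAt-h-reflects : ∀ F →
      Reflects (I ⊫ F) (eval (here I) (reduct (there I) F))
    satisfiesAt-h-reflects-children : ∀ F → satisfiesAt I t F →
      Reflects (I ⊫ F) (eval (here I) (reductChildren (there I) F))

    satisfiesAt-h-reflects F with eval (there I) F | satisfiesAt-t-reflects F
    ... | true  | ofʸ f  = satisfiesAt-h-reflects-children F f
    -- The reduct is `bot` here, and falsity at `t` passes down to `h` by contraposing
    -- `persistence`.
    ... | false | ofⁿ ¬f = ofⁿ (¬f ∘ persistence F)

    satisfiesAt-h-reflects-children (atom p)  _   = T-reflects (here I p)
    satisfiesAt-h-reflects-children bot       _   = ofⁿ λ ()
    satisfiesAt-h-reflects-children (F and G) _   =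
      satisfiesAt-h-reflects F ×-reflects satisfiesAt-h-reflects G
    satisfiesAt-h-reflects-children (F or G)  _   =
      satisfiesAt-h-reflects F ⊎-reflects satisfiesAt-h-reflects G
    satisfiesAt-h-reflects-children (F ⇒ G)   f⇒g =
      -- The reduct of an implication speaks only about the world `h`; the condition at `t` comes
      -- from the hypothesis that `there I` satisfies the implication.
      map-reflects (λ { f⇒gʰ h h≤h → f⇒gʰ ; _ t h≤t → f⇒g t t≤t })
        (λ f⇒gʰ → f⇒gʰ h h≤h)
        (¬-reflects (satisfiesAt-h-reflects F) ⊎-reflects satisfiesAt-h-reflects G)

    ⊨reduct⇔⊫ : ∀ F → here I ⊨ reduct (there I) F ⇔ I ⊫ F
    ⊨reduct⇔⊫ F = reflects⇒⇔ (satisfiesAt-h-reflects F)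

    ⊨ˢreductˢ⇔SoftHTModel : ∀ 𝔽 →
      here I ⊨ˢ reductˢ (there I) (dropWeights (satisfiedPart 𝔽 (there I))) ⇔
      SoftHTModel I 𝔽
    ⊨ˢreductˢ⇔SoftHTModel 𝔽 = mk⇔
      (λ m w R R∈ → Equivalence.to (⊨reduct⇔⊫ R) (m _ (R , (w , R∈) , refl)))
      (λ { m _ (R , (w , R∈) , refl) → Equivalence.from (⊨reduct⇔⊫ R) (m w R R∈) })

  -- Filtering keeps exactly the rules true in `X`, and reducing by `X` preserves their truth. Hence
  -- only minimality distinguishes soft stable models.
  ⊨ˢreductˢ-satisfiedPart : ∀ 𝔽 (X : Interpretation Atom) →
    X ⊨ˢ reductˢ X (dropWeights (satisfiedPart 𝔽 X))
  ⊨ˢreductˢ-satisfiedPart 𝔽 X _ (R , (w , R∈) , refl) =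
    subst T (sym (eval-reduct X R))
      (proj₂ (∈-filter⁻ (λ r → X ⊨? formula r) {xs = 𝔽} R∈))

proposition5 : ∀ {a} {Atom : Set a} (𝔽 : Program Atom) (X : Interpretation Atom) →
    SoftStableModel X 𝔽 ⇔ SoftEquilibriumModel (total X) 𝔽
proposition5 𝔽 X = mk⇔
  (λ (_ , minimal) → ((λ _ → id) , (λ _ → id)) ,
    λ Y Y⊂X → minimal Y Y⊂X ∘
      Equivalence.from (⊨ˢreductˢ⇔SoftHTModel (ht Y X (proj₁ Y⊂X)) 𝔽))
  -- Equilibrium supplies only the absence of smaller models; that `X` is itself a model comes from
  -- the filtering.
  (λ (_ , minimal) → ⊨ˢreductˢ-satisfiedPart 𝔽 X ,
    λ Y Y⊂X → minimal Y Y⊂X ∘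
      Equivalence.to (⊨ˢreductˢ⇔SoftHTModel (ht Y X (proj₁ Y⊂X)) 𝔽))
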